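{- Let $X$ and $J$ be finite, let $f\in\mathcal L(X,J)$ be generative, and let $C$ be a cell of $\Omega(X,J)$ of finite fanout such that $f$ generates all the formulas held in common knowledge in $C$, i.e. $F(C)=\underline{Ck}(\{f\})$. Then there is no uniform bound on the size of the possibility sets in $C$; that is, there is no $n\in\mathbb N$ such that every possibility set contained in $C$ has at most $n$ elements.
   Context: Formulas. $X$ (primitive propositions) and $J$ (agents) are finite sets. $\mathcal L=\mathcal L(X,J)$ is the smallest set of formulas containing $X$ and closed under $g\mapsto\neg g$, $(g,h)\mapsto g\wedge h$, and $g\mapsto k_jg$ for $j\in J$; $g\vee h$ and $g\to h$ are the usual abbreviations ($g\to h$ is $\neg g\vee h$). The multi-agent S5 logic has the rules modus ponens and necessitation (if $g$ is a theorem so is $k_jg$) and as axioms all substitution instances of propositional theorems, $(k_jg\wedge k_j(g\to h))\to k_jh$, $k_jg\to g$, $k_jg\to k_jk_jg$, $\neg k_jg\to k_j\neg k_jg$. A set of formulas is consistent if no finite subset leads to a contradiction in this logic, and complete if for each formula $g$ it contains $g$ or $\neg g$. $\Omega=\Omega(X,J)$ is the set of all complete and consistent subsets of $\mathcal L$. A tautology is a formula belonging to every $z\in\Omega$. Partitions, cells, topology. For $j\in J$, $\mathcal Q^j$ is the partition of $\Omega$ in which $z,z'$ are equivalent iff $\{g: k_jg\in z\}=\{g:k_jg\in z'\}$. A possibility set is a member of some $\mathcal Q^j$. A cell is a member of the meet partition $\bigwedge_{j\in J}\mathcal Q^j$, i.e. a minimal non-empty $C\subseteq\Omega$ such that $P\in\mathcal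 Q^j$ and $P\cap C\neq\emptyset$ imply $P\subseteq C$, for all $j$. A cell has finite fanout if every possibility set contained in it is finite. The topology of $\Omega$ has as base the sets $\{z\in\Omega: g\in z\}$, $g\in\mathcal L$. Let $E^0g=g$, $E g=\bigwedge_{j\in J}k_jg$, $E^{n}g=E(E^{n-1}g)$, and $\mathbf{Ck}(\{f\})=\{z\in\Omega: E^nf\in z\text{ for all }n\ge 0\}$. A cell $C$ is dense in $\mathbf{Ck}(\{f\})$ if $C\subseteq \mathbf{Ck}(\{f\})$ and $C$ is dense in it in the relative topology. For a cell $C$, $F(C)$ is the set of formulas $g$ held in common knowledge in $C$, i.e. with $E^ng\in z$ for all $n$ at any (equivalently every) $z\in C$; equivalently $F(C)=\{g: g\in z\text{ for all }z\in C\}$. $\underline{Ck}(\{f\})=\{g\in\mathcal L: \text{there is } i<\infty \text{ and a finite } T'\subseteq\{f\}\text{ with }(\bigwedge_{t\in T'}E^i t)\to g\text{ a tautology}\}$. Finite levels. Depth: $\mathrm{depth}(x)=0$ for $x\in X$, $\mathrm{depth}(\neg g)=\mathrm{depth}(g)$, $\mathrm{depth}(g\wedge h)=\max(\mathrm{depth}(g),\mathrm{depth}(h))$, $\mathrm{depth}(k_jg)=\mathrm{depth}(g)+1$. $\mathcal L_i$ is the set of formulas of depth $\le i$; $\Omega_i$ is the (finite) set of maximally consistent subsets of $\mathcal L_i$; $\pi_i:\Omega\to\Omega_i$, $\pi_i(z)=z\cap\mathcal L_i$ (surjective). $\mathcal G_i=\{\pi_i^{ -1}(w):w\in\Omega_i\}$.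 For $i\ge1$, $\overline{\mathcal F}_i^j$ is the partition of $\Omega_i$ in which $w,w'$ are equivalent iff $\{g\in\mathcal L_{i-1}:k_jg\in w\}=\{g\in\mathcal L_{i-1}:k_jg\in w'\}$; $\overline{\mathcal F}_0^j=\{\Omega_0\}$; $\mathcal F_i^j=\{\pi_i^{ -1}(B):B\in\overline{\mathcal F}_i^j\}$. For a formula $f$ of depth $d$, $\alpha^{\Omega_d}(f)=\{w\in\Omega_d:f\in w\}$. Generative formulas. For $i>0$ a non-empty $A\subseteq\Omega_i$ is semantically closed if for all $j\in J$, $B\in\mathcal G_{i-1}$, $w\in A$: if $\pi_i^{ -1}(w)\subseteq F\in\mathcal F_i^j$ and $F\cap B\ne\emptyset$ then $F\cap B\cap\pi_i^{ -1}(A)\neq\emptyset$. Every non-empty subset of $\Omega_0$ is semantically closed. A subset $A\subseteq\Omega_d$ is connected if any two of its elements are joined by a finite sequence in $A$ in which consecutive elements share a member of $\overline{\mathcal F}_d^j$ for some $j\in J$. A formula $f$ with $d=\mathrm{depth}(f)$ and $|J|\ge2$ is generative if $\alpha^{\Omega_d}(f)$ is semantically closed and connected, and there exists more than one cell dense in $\mathbf{Ck}(\{f\})$. -}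

module Defs where

open import Data.Bool.Base using (Bool; true; false; not; _∧_)
open import Data.Empty using (⊥)
open import Data.Fin.Base using (Fin)
open import Data.List.Base using (List; []; _∷_; map; allFin; length)
open import Data.List.Relation.Unary.All using (All; []; _∷_)
open import Data.List.Relation.Unary.Any using (Any)
open import Data.Nat.Base using (ℕ; zero; suc; _≤_; _⊔_)
open import Data.Product.Base using (_×_; _,_; ∃-syntax)
open import Data.Sum.Base using (_⊎_; inj₁; inj₂)
open import Data.Unit.Base using (⊤)
open import Level using (Level; 0ℓ) renaming (suc to lsuc)
open import Relation.Binary.Core using (Rel)
open import Relation.Binary.Construct.Closure.ReflexiveTransitive using (Star)
open import Relation.Binary.PropositionalEquality.Core using (_≡_; refl)
open import Relation.Nullary.Negation.Core using (¬_; contradiction)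
open import Relation.Unary using (Pred; _∈_; _⊆_; _≐_; _∩_; _≬_; _⊢_; ｛_｝; Satisfiable)

data Formula (X J : Set) : Set where
  var  : X → Formula X J
  ¬ᶠ_  : Formula X J → Formula X J
  _∧ᶠ_ : Formula X J → Formula X J → Formula X J
  K    : J → Formula X J → Formula X J

infix  9 ¬ᶠ_
infixr 8 _∧ᶠ_
infixr 7 _∨ᶠ_
infixr 6 _→ᶠ_

_∨ᶠ_ : {X J : Set} → Formula X J → Formula X J → Formula X J
g ∨ᶠ h = ¬ᶠ (¬ᶠ g ∧ᶠ ¬ᶠ h)

_→ᶠ_ : {X J : Set} → Formula X J → Formula X J → Formula X J
g →ᶠ h = ¬ᶠ g ∨ᶠ h

-- The language has no constant for truth, so the empty conjunction is
-- written with the help of an auxiliary formula d, which plays no role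
-- for non-empty lists.
⋀ : {X J : Set} → Formula X J → List (Formula X J) → Formula X J
⋀ d []             = d →ᶠ d
⋀ d (g ∷ [])       = g
⋀ d (g ∷ gs@(_ ∷ _)) = g ∧ᶠ ⋀ d gs

depth : {X J : Set} → Formula X J → ℕ
depth (var x)  = 0
depth (¬ᶠ g)   = depth g
depth (g ∧ᶠ h) = depth g ⊔ depth h
depth (K j g)  = suc (depth g)

-- Propositional formulas are the formulas over a countable supply of
-- variables and no agents.

PropFormula : Set
PropFormula = Formula ℕ ⊥

eval : (ℕ → Bool) → PropFormula → Bool
eval v (var x)  = v x
eval v (¬ᶠ p)   = not (eval v p)
eval v (p ∧ᶠ q) = eval v p ∧ eval v q

PropTheorem : PropFormula → Set
PropTheorem p = ∀ v → eval v p ≡ true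

_[_] : {X J : Set} → PropFormula → (ℕ → Formula X J) → Formula X J
var x    [ σ ] = σ x
(¬ᶠ p)   [ σ ] = ¬ᶠ (p [ σ ])
(p ∧ᶠ q) [ σ ] = (p [ σ ]) ∧ᶠ (q [ σ ])

infix 3 S5⊢_

data S5⊢_ {X J : Set} : Formula X J → Set where
  prop : ∀ p → PropTheorem p → ∀ σ → S5⊢ p [ σ ]
  axK  : ∀ j g h → S5⊢ (K j g ∧ᶠ K j (g →ᶠ h)) →ᶠ K j h
  axT  : ∀ j g → S5⊢ K j g →ᶠ g
  ax4  : ∀ j g → S5⊢ K j g →ᶠ K j (K j g)
  ax5  : ∀ j g → S5⊢ ¬ᶠ K j g →ᶠ K j (¬ᶠ K j g)
  mp   : ∀ {g h} → S5⊢ g → S5⊢ g →ᶠ h → S5⊢ h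
  nec  : ∀ j {g} → S5⊢ g → S5⊢ K j g

-- The finite sets X and J are Fin m and Fin k.

private variable
  m k : ℕ
  a : Level

𝓛 : ℕ → ℕ → Set
𝓛 m k = Formula (Fin m) (Fin k)

Consistent : Pred (𝓛 m k) 0ℓ → Set
Consistent S = ∀ gs g → All (_∈ S) gs → ¬ (S5⊢ ⋀ g gs →ᶠ (g ∧ᶠ ¬ᶠ g))

Complete : Pred (𝓛 m k) 0ℓ → Set
Complete S = ∀ g → g ∈ S ⊎ ¬ᶠ g ∈ S

-- Points of Ω are identified when their sets of formulas are, so equality
-- on Ω is _≈_ below rather than _≡_; likewise for the finite levels.

record Ω (m k : ℕ) : Set₁ where
  field
    set        : Pred (𝓛 m k) 0ℓ
    complete   : Complete set
    consistent : Consistent set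

open Ω public using (set)

infix 4 _≈_

_≈_ : Rel (Ω m k) 0ℓ
z ≈ z′ = set z ≐ set z′

⟦_⟧ : 𝓛 m k → Pred (Ω m k) 0ℓ
⟦ g ⟧ z = g ∈ set z

Tautology : 𝓛 m k → Set₁
Tautology g = ∀ z → z ∈ ⟦ g ⟧

-- A partition is given by its equivalence relation; its members are the
-- equivalence classes.

Members : {A : Set a} → Rel A 0ℓ → Pred (Pred A 0ℓ) a
Members _∼_ P = ∃[ x ] P ≐ (x ∼_)

known : Fin k → Pred (𝓛 m k) 0ℓ → Pred (𝓛 m k) 0ℓ
known j S g = K j g ∈ S

𝓠 : Fin k → Pred (Pred (Ω m k) 0ℓ) (lsuc 0ℓ)
𝓠 j = Members λ z z′ → known j (set z) ≐ known j (set z′)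

PossibilitySet : Pred (Pred (Ω m k) 0ℓ) (lsuc 0ℓ)
PossibilitySet P = ∃[ j ] P ∈ 𝓠 j

Saturated : Pred (Ω m k) (lsuc 0ℓ) → Set₁
Saturated C = ∀ j P → P ∈ 𝓠 j → P ≬ C → P ⊆ C

IsCell : Pred (Ω m k) (lsuc 0ℓ) → Set₂
IsCell C = Satisfiable C × Saturated C ×
  (∀ D → Satisfiable D → Saturated D → D ⊆ C → C ⊆ D)

HasAtMost : ℕ → Pred (Ω m k) 0ℓ → Set₁
HasAtMost n P = ∃[ zs ] length zs ≤ n × (∀ {z} → z ∈ P → Any (z ≈_) zs)

Finite : Pred (Ω m k) 0ℓ → Set₁
Finite P = ∃[ n ] HasAtMost n P

FiniteFanout : Pred (Ω m k) (lsuc 0ℓ) → Set₁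
FiniteFanout C = ∀ P → PossibilitySet P → P ⊆ C → Finite P

Open : Pred (Ω m k) (lsuc 0ℓ) → Set₁
Open U = ∀ {z} → z ∈ U → ∃[ g ] z ∈ ⟦ g ⟧ × ⟦ g ⟧ ⊆ U

_DenseIn_ : Pred (Ω m k) (lsuc 0ℓ) → Pred (Ω m k) 0ℓ → Set₂
C DenseIn S = C ⊆ S × (∀ U → Open U → U ≬ S → U ≬ C)

E : 𝓛 m k → 𝓛 m k
E {k = k} g = ⋀ g (map (λ j → K j g) (allFin k))

E^ : ℕ → 𝓛 m k → 𝓛 m k
E^ zero    g = g
E^ (suc n) g = E (E^ n g)

𝐂𝐤 : Pred (𝓛 m k) 0ℓ → Pred (Ω m k) 0ℓ
𝐂𝐤 T z = ∀ {t} → t ∈ T → ∀ n → z ∈ ⟦ E^ n t ⟧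

F : Pred (Ω m k) (lsuc 0ℓ) → Pred (𝓛 m k) (lsuc 0ℓ)
F C g = ∀ {z} → z ∈ C → ∀ n → z ∈ ⟦ E^ n g ⟧

-- The underlined Ck, as opposed to the set of points 𝐂𝐤.
C̲k̲ : Pred (𝓛 m k) 0ℓ → Pred (𝓛 m k) (lsuc 0ℓ)
C̲k̲ T g = ∃[ i ] ∃[ ts ] All (_∈ T) ts × Tautology (⋀ g (map (E^ i) ts) →ᶠ g)

𝓛≤ : ℕ → Pred (𝓛 m k) 0ℓ
𝓛≤ i g = depth g ≤ i

record Ωᵢ (m k i : ℕ) : Set₁ where
  field
    set        : Pred (𝓛 m k) 0ℓ
    bounded    : set ⊆ 𝓛≤ i
    consistent : Consistent set
    maximal    : ∀ S → S ⊆ 𝓛≤ i → Consistent S → set ⊆ S → S ⊆ set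

open Ωᵢ public using () renaming (set to setᵢ)

infix 4 _≈ᵢ_

_≈ᵢ_ : ∀ {i} → Rel (Ωᵢ m k i) 0ℓ
w ≈ᵢ w′ = setᵢ w ≐ setᵢ w′

π : ∀ i → Ω m k → Ωᵢ m k i
π i z = record
  { set        = set z ∩ 𝓛≤ i
  ; bounded    = λ (_ , d) → d
  ; consistent = λ gs g all → Ω.consistent z gs g (proj₁s all)
  ; maximal    = maximal
  }
  where
  proj₁s : ∀ {gs} → All (_∈ set z ∩ 𝓛≤ i) gs → All (_∈ set z) gs
  proj₁s []             = []
  proj₁s ((p , _) ∷ ps) = p ∷ proj₁s ps

  p→p : PropFormula
  p→p = var 0 →ᶠ var 0

  p→p-theorem : PropTheorem p→p
  p→p-theorem v with v 0
  ... | true  = refl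
  ... | false = refl

  maximal : ∀ S → S ⊆ 𝓛≤ i → Consistent S → set z ∩ 𝓛≤ i ⊆ S → S ⊆ set z ∩ 𝓛≤ i
  maximal S S⊆ con z⊆S {g} g∈S with Ω.complete z g
  ... | inj₁ g∈z  = g∈z , S⊆ g∈S
  ... | inj₂ ¬g∈z = contradiction (prop p→p p→p-theorem (λ _ → g ∧ᶠ ¬ᶠ g))
    (con (g ∷ ¬ᶠ g ∷ []) g (g∈S ∷ z⊆S (¬g∈z , S⊆ g∈S) ∷ []))

π⁻¹ : ∀ {i} → Ωᵢ m k i → Pred (Ω m k) 0ℓ
π⁻¹ {i = i} w z = π i z ≈ᵢ w

𝓖 : ℕ → Pred (Pred (Ω m k) 0ℓ) (lsuc 0ℓ)
𝓖 i B = ∃[ w ] B ≐ π⁻¹ {i = i} w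

SameF̄ : ∀ i → Fin k → Rel (Ωᵢ m k i) 0ℓ
SameF̄ zero    j w w′ = ⊤
SameF̄ (suc i) j w w′ = (known j (setᵢ w) ∩ 𝓛≤ i) ≐ (known j (setᵢ w′) ∩ 𝓛≤ i)

𝓕̄ : ∀ i → Fin k → Pred (Pred (Ωᵢ m k i) 0ℓ) (lsuc 0ℓ)
𝓕̄ i j = Members (SameF̄ i j)

𝓕 : ∀ i → Fin k → Pred (Pred (Ω m k) 0ℓ) (lsuc 0ℓ)
𝓕 i j P = ∃[ B ] B ∈ 𝓕̄ i j × P ≐ (π i ⊢ B)

α : ∀ i → 𝓛 m k → Pred (Ωᵢ m k i) 0ℓ
α i f w = f ∈ setᵢ w

-- Subsets A of Ωᵢ are meant to be closed under _≈ᵢ_, as α i f is; π i ⊢ A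
-- is then the preimage of A.
SemanticallyClosed : ∀ i → Pred (Ωᵢ m k i) 0ℓ → Set₁
SemanticallyClosed zero    A = Satisfiable A
SemanticallyClosed (suc i) A = Satisfiable A ×
  (∀ j B w P → B ∈ 𝓖 i → w ∈ A → P ∈ 𝓕 (suc i) j → π⁻¹ w ⊆ P →
   P ≬ B → Satisfiable (P ∩ B ∩ (π (suc i) ⊢ A)))

Adjacent : ∀ {i} → Pred (Ωᵢ m k i) 0ℓ → Rel (Ωᵢ m k i) (lsuc 0ℓ)
Adjacent {i = i} A w w′ =
  w ∈ A × w′ ∈ A × ∃[ j ] ∃[ B ] B ∈ 𝓕̄ i j × w ∈ B × w′ ∈ B

Connected : ∀ {i} → Pred (Ωᵢ m k i) 0ℓ → Set₁
Connected A = ∀ {w w′} → w ∈ A → w′ ∈ A → Star (Adjacent A) w w′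

Generative : 𝓛 m k → Set₂
Generative {k = k} f =
  2 ≤ k ×
  SemanticallyClosed (depth f) (α (depth f) f) ×
  Connected (α (depth f) f) ×
  (∃[ C ] ∃[ C′ ] IsCell C × IsCell C′ ×
    C DenseIn 𝐂𝐤 ｛ f ｝ × C′ DenseIn 𝐂𝐤 ｛ f ｝ × ¬ (C ≐ C′))

-- Let S = 𝐂𝐤 ｛ f ｝.  A set of points of S among which an agent's knowledge at
-- depth e ≥ depth f is constant can be copied into a new possibility set inside
-- S without changing any type at depth e + 1.  Hence whenever some agent's
-- knowledge at depth e fails to determine the (e + 1)-types it allows, a larger
-- possibility set can be built, and such branching passes from agent to agent
-- at increasing depths.  If it occurs above every type of a cell dense in S,
-- possibility sets in S have no uniform bound; as C approximates the points of
-- S at every depth, those of C have none either.  Otherwise some point of the cell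
-- is isolated in S, so every cell dense in S contains it, against the existence
-- of two dense cells.

module Submission where

open import Axiom.ExcludedMiddle using (ExcludedMiddle)
open import Data.Bool.Base using (Bool; true; false; T; _∧_)
open import Data.Empty using (⊥; ⊥-elim)
open import Data.Fin.Base using (Fin; zero; suc; fromℕ<)
import Data.Fin.Properties as Fin
open import Data.List.Base using (List; []; _∷_; map; allFin; lookup; _++_; cartesianProductWith)
open import Data.List.Membership.Propositional using () renaming (_∈_ to _∈ˡ_)
open import Data.List.Membership.Propositional.Properties
  using (∈-map⁺; ∈-map⁻; ∈-++⁺ˡ; ∈-++⁺ʳ; ∈-++⁻; ∈-cartesianProductWith⁺; ∈-allFin)
open import Data.List.Relation.Unary.All as All using (All; []; _∷_)
import Data.List.Relation.Unary.All.Properties as All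
open import Data.List.Relation.Unary.Any as Any using (Any; here; there)
open import Data.List.Relation.Unary.Any.Properties using (lookup-index)
open import Data.Maybe.Base using (Maybe; just; nothing)
open import Data.Nat.Base using (ℕ; zero; suc; _≤_; z≤n; s≤s; s≤s⁻¹; _⊔_; _+_; _≤′_; ≤′-refl; ≤′-step)
open import Data.Nat.Properties
  using (≤-refl; ≤-trans; m≤m⊔n; m≤n⊔m; ⊔-lub; m⊔n≤o⇒m≤o; m⊔n≤o⇒n≤o; n≤1+n;
         ≤⇒≤′; m≤m+n; m≤n+m; +-suc; +-identityʳ)
open import Data.Product.Base using (Σ-syntax; _×_; _,_; ∃-syntax; proj₁; proj₂; swap)
open import Data.Sum.Base using (_⊎_; inj₁; inj₂)
open import Data.Unit.Base using (⊤; tt)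
open import Function.Base using (_∘_; id)
open import Level using (Lift; lift; lower; 0ℓ) renaming (suc to lsuc)
open import Relation.Binary.PropositionalEquality as ≡ using (_≡_; _≢_; refl; sym; trans; cong; subst)
open import Relation.Nullary.Decidable.Core
  using (yes; no; does; proof; True; toWitness; fromWitness; decidable-stable)
open import Relation.Nullary.Reflects using (Reflects; invert; ¬-reflects; _×-reflects_)
open import Relation.Nullary.Negation.Core using (¬_; contradiction)
open import Relation.Unary using (Pred; _∈_; _∉_; _⊆_; _≐_; _∪_; _∩_; _≬_; ｛_｝; Satisfiable)
open import Defs

private variable
  m k : ℕ

-- Propositional tautologies by truth tables

valuation : Bool → Bool → Bool → ℕ → Bool
valuation a b c 0 = a
valuation a b c 1 = b
valuation a b c _ = c

everywhere : (Bool → Bool) → Bool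
everywhere P = P false ∧ P true

everywhere-sound : ∀ P → T (everywhere P) → ∀ b → P b ≡ true
everywhere-sound P t b with P false in p | P true in q
everywhere-sound P t false | true | true = p
everywhere-sound P t true  | true | true = q

truthTable : PropFormula → Bool
truthTable p = everywhere λ a → everywhere λ b → everywhere λ c → eval (valuation a b c) p

truthTable-sound : ∀ p → T (truthTable p) → ∀ a b c → eval (valuation a b c) p ≡ true
truthTable-sound p t a b c =
  everywhere-sound (λ c → eval (valuation a b c) p)
    (holds (everywhere-sound (λ b → everywhere λ c → eval (valuation a b c) p)
      (holds (everywhere-sound (λ a → everywhere λ b → everywhere λ c → eval (valuation a b c) p) t a)) b)) c
  where
  holds : ∀ {x} → x ≡ true → T x
  holds refl = tt

⟨_,_,_⟩ : {A : Set} → A → A → A → ℕ → A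
⟨ a , b , c ⟩ 0 = a
⟨ a , b , c ⟩ 1 = b
⟨ a , b , c ⟩ _ = c

private
  A B C : PropFormula
  A = var 0
  B = var 1
  C = var 2

module _ (g h i : 𝓛 m k) where
  -- The third hypothesis says that p has no variables besides A, B and C.
  instantiate : ∀ p → T (truthTable p) → (∀ v → eval v p ≡ eval (valuation (v 0) (v 1) (v 2)) p) →
    S5⊢ p [ ⟨ g , h , i ⟩ ]
  instantiate p t e = prop p (λ v → trans (e v) (truthTable-sound p t (v 0) (v 1) (v 2))) ⟨ g , h , i ⟩

⊢-I : ∀ (g : 𝓛 m k) → S5⊢ g →ᶠ g
⊢-I g = instantiate g g g (A →ᶠ A) tt (λ _ → refl)

⊢-K : ∀ (g h : 𝓛 m k) → S5⊢ g →ᶠ h →ᶠ g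
⊢-K g h = instantiate g h g (A →ᶠ B →ᶠ A) tt (λ _ → refl)

⊢-S : ∀ (g h i : 𝓛 m k) → S5⊢ (g →ᶠ h →ᶠ i) →ᶠ (g →ᶠ h) →ᶠ g →ᶠ i
⊢-S g h i = instantiate g h i ((A →ᶠ B →ᶠ C) →ᶠ (A →ᶠ B) →ᶠ A →ᶠ C) tt (λ _ → refl)

⊢-modus : ∀ (g h : 𝓛 m k) → S5⊢ g ∧ᶠ (g →ᶠ h) ∧ᶠ ¬ᶠ h →ᶠ g ∧ᶠ ¬ᶠ g
⊢-modus g h = instantiate g h g (A ∧ᶠ (A →ᶠ B) ∧ᶠ ¬ᶠ B →ᶠ A ∧ᶠ ¬ᶠ A) tt (λ _ → refl)

⊢-pair : ∀ (g h : 𝓛 m k) → S5⊢ g →ᶠ h →ᶠ g ∧ᶠ h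
⊢-pair g h = instantiate g h g (A →ᶠ B →ᶠ A ∧ᶠ B) tt (λ _ → refl)

⊢-fst : ∀ (g h : 𝓛 m k) → S5⊢ g ∧ᶠ h →ᶠ g
⊢-fst g h = instantiate g h g (A ∧ᶠ B →ᶠ A) tt (λ _ → refl)

⊢-snd : ∀ (g h : 𝓛 m k) → S5⊢ g ∧ᶠ h →ᶠ h
⊢-snd g h = instantiate g h g (A ∧ᶠ B →ᶠ B) tt (λ _ → refl)

⊢-¬-intro : ∀ (g h : 𝓛 m k) → S5⊢ (g →ᶠ h) →ᶠ (g →ᶠ ¬ᶠ h) →ᶠ ¬ᶠ g
⊢-¬-intro g h = instantiate g h g ((A →ᶠ B) →ᶠ (A →ᶠ ¬ᶠ B) →ᶠ ¬ᶠ A) tt (λ _ → refl)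

⊢-reductio : ∀ (g h : 𝓛 m k) → S5⊢ (¬ᶠ g →ᶠ h) →ᶠ (¬ᶠ g →ᶠ ¬ᶠ h) →ᶠ g
⊢-reductio g h = instantiate g h g ((¬ᶠ A →ᶠ B) →ᶠ (¬ᶠ A →ᶠ ¬ᶠ B) →ᶠ A) tt (λ _ → refl)

-- Derivations from hypotheses

infix 3 _⊩_

-- Necessitation is available only for theorems, through `thm`; this is what makes the deduction
-- theorem hold.
data _⊩_ (Γ : Pred (𝓛 m k) 0ℓ) : 𝓛 m k → Set where
  hyp : ∀ {g} → g ∈ Γ → Γ ⊩ g
  thm : ∀ {g} → S5⊢ g → Γ ⊩ g
  mp  : ∀ {g h} → Γ ⊩ g → Γ ⊩ g →ᶠ h → Γ ⊩ h

private variable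
  Γ Δ : Pred (𝓛 m k) 0ℓ

weaken : Γ ⊆ Δ → ∀ {g} → Γ ⊩ g → Δ ⊩ g
weaken s (hyp x)  = hyp (s x)
weaken s (thm x)  = thm x
weaken s (mp d e) = mp (weaken s d) (weaken s e)

deduction : ∀ {a g : 𝓛 m k} → Γ ∪ ｛ a ｝ ⊩ g → Γ ⊩ a →ᶠ g
deduction {a = a} {g} (hyp (inj₁ x))    = mp (hyp x) (thm (⊢-K g a))
deduction {a = a}     (hyp (inj₂ refl)) = thm (⊢-I a)
deduction {a = a} {g} (thm x)           = mp (thm x) (thm (⊢-K g a))
deduction {a = a} {g} (mp {h} d e)      =
  mp (deduction d) (mp (deduction e) (thm (⊢-S a h g)))

Contradictory : Pred (𝓛 m k) 0ℓ → Set
Contradictory Γ = ∃[ g ] (Γ ⊩ g) × (Γ ⊩ ¬ᶠ g)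

contradictory-¬ : ∀ {a : 𝓛 m k} → Contradictory (Γ ∪ ｛ a ｝) → Γ ⊩ ¬ᶠ a
contradictory-¬ {a = a} (h , d , e) = mp (deduction e) (mp (deduction d) (thm (⊢-¬-intro a h)))

contradictory-reductio : ∀ {a : 𝓛 m k} → Contradictory (Γ ∪ ｛ ¬ᶠ a ｝) → Γ ⊩ a
contradictory-reductio {a = a} (h , d , e) = mp (deduction e) (mp (deduction d) (thm (⊢-reductio a h)))

⋀-⊩ : ∀ {d : 𝓛 m k} gs → All (_∈ Γ) gs → Γ ⊩ ⋀ d gs
⋀-⊩ {d = d} []           []       = thm (⊢-I d)
⋀-⊩         (g ∷ [])     (p ∷ []) = hyp p
⋀-⊩ {d = d} (g ∷ h ∷ gs) (p ∷ ps) = mp (⋀-⊩ (h ∷ gs) ps) (mp (hyp p) (thm (⊢-pair g (⋀ d (h ∷ gs)))))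

noncontradictory⇒consistent : ¬ Contradictory Γ → Consistent Γ
noncontradictory⇒consistent nc gs g all d =
  nc (g , mp both (thm (⊢-fst g (¬ᶠ g))) , mp both (thm (⊢-snd g (¬ᶠ g))))
  where
  both = mp (⋀-⊩ gs all) (thm d)

-- Finite lists exhausting the language

height : 𝓛 m k → ℕ
height (var x)  = 0
height (¬ᶠ g)   = suc (height g)
height (g ∧ᶠ h) = suc (height g ⊔ height h)
height (K j g)  = suc (height g)

-- Bounded height, unlike bounded depth, leaves only finitely many formulas, so each Lindenbaum
-- stage decides a finite list.
formulas : ∀ m k → ℕ → List (𝓛 m k)
formulas m k zero    = map var (allFin m)
formulas m k (suc n) = map var (allFin m) ++ map ¬ᶠ_ gs ++
  cartesianProductWith _∧ᶠ_ gs gs ++ cartesianProductWith K (allFin k) gs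
  where gs = formulas m k n

∈-formulas : ∀ (g : 𝓛 m k) n → height g ≤ n → g ∈ˡ formulas m k n
∈-formulas (var x) zero    _ = ∈-map⁺ var (∈-allFin x)
∈-formulas (var x) (suc n) _ = ∈-++⁺ˡ (∈-map⁺ var (∈-allFin x))
∈-formulas {m} (¬ᶠ g) (suc n) (s≤s l) = ∈-++⁺ʳ (map var (allFin m)) (∈-++⁺ˡ (∈-map⁺ ¬ᶠ_ (∈-formulas g n l)))
∈-formulas {m} {k} (g ∧ᶠ h) (suc n) (s≤s l) =
  ∈-++⁺ʳ (map var (allFin m)) (∈-++⁺ʳ (map ¬ᶠ_ (formulas m k n)) (∈-++⁺ˡ
    (∈-cartesianProductWith⁺ _∧ᶠ_ (∈-formulas g n (m⊔n≤o⇒m≤o _ _ l)) (∈-formulas h n (m⊔n≤o⇒n≤o _ _ l)))))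
∈-formulas {m} {k} (K j g) (suc n) (s≤s l) =
  ∈-++⁺ʳ (map var (allFin m)) (∈-++⁺ʳ (map ¬ᶠ_ gs) (∈-++⁺ʳ (cartesianProductWith _∧ᶠ_ gs gs)
    (∈-cartesianProductWith⁺ K (∈-allFin j) (∈-formulas g n l))))
  where gs = formulas m k n

module Classical (em : ∀ {ℓ} → ExcludedMiddle ℓ) where

  dne : ∀ {ℓ} {P : Set ℓ} → ¬ ¬ P → P
  dne = decidable-stable em

  -- Lindenbaum's lemma

  decide : Pred (𝓛 m k) 0ℓ → 𝓛 m k → Pred (𝓛 m k) 0ℓ
  decide Γ g with em {P = Contradictory (Γ ∪ ｛ g ｝)}
  ... | no  _ = Γ ∪ ｛ g ｝
  ... | yes _ = Γ ∪ ｛ ¬ᶠ g ｝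

  decide-⊇ : ∀ (Γ : Pred (𝓛 m k) 0ℓ) g → Γ ⊆ decide Γ g
  decide-⊇ Γ g x with em {P = Contradictory (Γ ∪ ｛ g ｝)}
  ... | no  _ = inj₁ x
  ... | yes _ = inj₁ x

  decide-decides : ∀ (Γ : Pred (𝓛 m k) 0ℓ) g → g ∈ decide Γ g ⊎ ¬ᶠ g ∈ decide Γ g
  decide-decides Γ g with em {P = Contradictory (Γ ∪ ｛ g ｝)}
  ... | no  _ = inj₁ (inj₂ refl)
  ... | yes _ = inj₂ (inj₂ refl)

  -- If both extensions were contradictory, `Γ` would already derive `g` and `¬ᶠ g`.
  decide-noncontradictory : ∀ (Γ : Pred (𝓛 m k) 0ℓ) g → ¬ Contradictory Γ → ¬ Contradictory (decide Γ g)
  decide-noncontradictory Γ g nc with em {P = Contradictory (Γ ∪ ｛ g ｝)}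
  ... | no ¬c = ¬c
  ... | yes c = λ c′ → nc (g , contradictory-reductio c′ , contradictory-¬ c)

  decideAll : Pred (𝓛 m k) 0ℓ → List (𝓛 m k) → Pred (𝓛 m k) 0ℓ
  decideAll Γ []       = Γ
  decideAll Γ (g ∷ gs) = decideAll (decide Γ g) gs

  decideAll-⊇ : ∀ (Γ : Pred (𝓛 m k) 0ℓ) gs → Γ ⊆ decideAll Γ gs
  decideAll-⊇ Γ []       x = x
  decideAll-⊇ Γ (g ∷ gs) x = decideAll-⊇ (decide Γ g) gs (decide-⊇ Γ g x)

  decideAll-decides : ∀ (Γ : Pred (𝓛 m k) 0ℓ) {g} gs → g ∈ˡ gs →
    g ∈ decideAll Γ gs ⊎ ¬ᶠ g ∈ decideAll Γ gs
  decideAll-decides Γ (g ∷ gs) (here refl) with decide-decides Γ g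
  ... | inj₁ x = inj₁ (decideAll-⊇ (decide Γ g) gs x)
  ... | inj₂ x = inj₂ (decideAll-⊇ (decide Γ g) gs x)
  decideAll-decides Γ (g ∷ gs) (there x) = decideAll-decides (decide Γ g) gs x

  decideAll-noncontradictory : ∀ (Γ : Pred (𝓛 m k) 0ℓ) gs →
    ¬ Contradictory Γ → ¬ Contradictory (decideAll Γ gs)
  decideAll-noncontradictory Γ []       nc = nc
  decideAll-noncontradictory Γ (g ∷ gs) nc =
    decideAll-noncontradictory (decide Γ g) gs (decide-noncontradictory Γ g nc)

  module Lindenbaum (Γ : Pred (𝓛 m k) 0ℓ) (nc : ¬ Contradictory Γ) where

    stage : ℕ → Pred (𝓛 m k) 0ℓ
    stage zero    = Γ
    stage (suc n) = decideAll (stage n) (formulas m k n)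

    stage-noncontradictory : ∀ n → ¬ Contradictory (stage n)
    stage-noncontradictory zero    = nc
    stage-noncontradictory (suc n) =
      decideAll-noncontradictory (stage n) (formulas m k n) (stage-noncontradictory n)

    stage-⊇′ : ∀ {i n} → i ≤′ n → stage i ⊆ stage n
    stage-⊇′ ≤′-refl             x = x
    stage-⊇′ (≤′-step {n = n} l) x = decideAll-⊇ (stage n) (formulas m k n) (stage-⊇′ l x)

    stage-⊇ : ∀ {i n} → i ≤ n → stage i ⊆ stage n
    stage-⊇ l = stage-⊇′ (≤⇒≤′ l)

    limit : Pred (𝓛 m k) 0ℓ
    limit g = ∃[ n ] g ∈ stage n

    -- A derivation uses finitely many hypotheses, and the stages increase.
    limit-⊩ : ∀ {g} → limit ⊩ g → ∃[ n ] (stage n ⊩ g)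
    limit-⊩ (hyp (n , x)) = n , hyp x
    limit-⊩ (thm x)       = 0 , thm x
    limit-⊩ (mp d e) with limit-⊩ d | limit-⊩ e
    ... | n , d′ | n′ , e′ = n ⊔ n′ ,
      mp (weaken (stage-⊇ (m≤m⊔n n n′)) d′) (weaken (stage-⊇ (m≤n⊔m n n′)) e′)

    limit-complete : Complete limit
    limit-complete g
      with decideAll-decides (stage (height g)) (formulas m k (height g)) (∈-formulas g _ ≤-refl)
    ... | inj₁ x = inj₁ (suc (height g) , x)
    ... | inj₂ x = inj₂ (suc (height g) , x)

    limit-noncontradictory : ¬ Contradictory limit
    limit-noncontradictory (g , d , e) with limit-⊩ d | limit-⊩ e
    ... | n , d′ | n′ , e′ = stage-noncontradictory (n ⊔ n′)
      (g , weaken (stage-⊇ (m≤m⊔n n n′)) d′ , weaken (stage-⊇ (m≤n⊔m n n′)) e′)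

    extension : Ω m k
    extension = record
      { set        = limit
      ; complete   = limit-complete
      ; consistent = noncontradictory⇒consistent limit-noncontradictory
      }

    extension-⊇ : Γ ⊆ set extension
    extension-⊇ x = 0 , x

  -- Closure properties of complete consistent sets

  module _ (z : Ω m k) where

    ∈-exclusive : ∀ {g} → g ∈ set z → ¬ᶠ g ∉ set z
    ∈-exclusive {g} x y = Ω.consistent z (g ∷ ¬ᶠ g ∷ []) g (x ∷ y ∷ []) (⊢-I (g ∧ᶠ ¬ᶠ g))

    ∉⇒¬∈ : ∀ {g} → g ∉ set z → ¬ᶠ g ∈ set z
    ∉⇒¬∈ {g} x with Ω.complete z g
    ... | inj₁ y = contradiction y x
    ... | inj₂ y = y

    ¬∉⇒∈ : ∀ {g} → ¬ᶠ g ∉ set z → g ∈ set z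
    ¬∉⇒∈ {g} x with Ω.complete z g
    ... | inj₁ y = y
    ... | inj₂ y = contradiction y x

    ∈-theorem : ∀ {g} → S5⊢ g → g ∈ set z
    ∈-theorem {g} d = ¬∉⇒∈ λ x →
      Ω.consistent z (¬ᶠ g ∷ []) g (x ∷ []) (mp d (⊢-pair g (¬ᶠ g)))

    ∈-mp : ∀ {g h} → g ∈ set z → (g →ᶠ h) ∈ set z → h ∈ set z
    ∈-mp {g} {h} x y = ¬∉⇒∈ λ w →
      Ω.consistent z (g ∷ g →ᶠ h ∷ ¬ᶠ h ∷ []) g (x ∷ y ∷ w ∷ []) (⊢-modus g h)

    ∈-pair : ∀ {g h} → g ∈ set z → h ∈ set z → (g ∧ᶠ h) ∈ set z
    ∈-pair {g} {h} x y = ∈-mp y (∈-mp x (∈-theorem (⊢-pair g h)))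

    ∈-fst : ∀ {g h} → (g ∧ᶠ h) ∈ set z → g ∈ set z
    ∈-fst {g} {h} x = ∈-mp x (∈-theorem (⊢-fst g h))

    ∈-snd : ∀ {g h} → (g ∧ᶠ h) ∈ set z → h ∈ set z
    ∈-snd {g} {h} x = ∈-mp x (∈-theorem (⊢-snd g h))

    ∈-⋀⁺ : ∀ {d} gs → All (_∈ set z) gs → ⋀ d gs ∈ set z
    ∈-⋀⁺ {d} []       _        = ∈-theorem (⊢-I d)
    ∈-⋀⁺ (g ∷ [])     (x ∷ []) = x
    ∈-⋀⁺ (g ∷ h ∷ gs) (x ∷ xs) = ∈-pair x (∈-⋀⁺ (h ∷ gs) xs)

    ∈-⋀⁻ : ∀ {d} gs → ⋀ d gs ∈ set z → All (_∈ set z) gs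
    ∈-⋀⁻ []           x = []
    ∈-⋀⁻ (g ∷ [])     x = x ∷ []
    ∈-⋀⁻ (g ∷ h ∷ gs) x = ∈-fst x ∷ ∈-⋀⁻ (h ∷ gs) (∈-snd x)

    ∈-E⁺ : ∀ {g} → (∀ j → K j g ∈ set z) → E g ∈ set z
    ∈-E⁺ {g} x = ∈-⋀⁺ (map (λ j → K j g) (allFin k)) (All.map⁺ (All.universal x (allFin k)))

    ∈-E⁻ : ∀ {g} → E g ∈ set z → ∀ j → K j g ∈ set z
    ∈-E⁻ {g} x j = All.lookup (All.map⁻ (∈-⋀⁻ (map (λ j → K j g) (allFin k)) x)) (∈-allFin j)

    -- Necessitation handles theorems and `axK` handles modus ponens.
    known-⊩ : ∀ {j g} → known j (set z) ⊩ g → K j g ∈ set z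
    known-⊩         (hyp x)        = x
    known-⊩ {j}     (thm x)        = ∈-theorem (nec j x)
    known-⊩ {j} {h} (mp {g} d₁ d₂) = ∈-mp (∈-pair (known-⊩ d₁) (known-⊩ d₂)) (∈-theorem (axK j g h))

  -- Accessibility between points

  record Accessible (j : Fin k) (z z′ : Ω m k) : Set where
    constructor accessible
    field known-≐ : known j (set z) ≐ known j (set z′)

  open Accessible

  private variable
    j     : Fin k
    e e′  : ℕ
    x y z : Ω m k

  A-refl : Accessible j z z
  A-refl = accessible (id , id)

  A-sym : Accessible j x y → Accessible j y x
  A-sym (accessible p) = accessible (swap p)

  A-trans : Accessible j x y → Accessible j y z → Accessible j x z
  A-trans (accessible (p , q)) (accessible (p′ , q′)) =
    accessible ((λ a → p′ (p a)) , (λ a → q (q′ a)))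

  K⇒ : ∀ {g} → Accessible j x y → K j g ∈ set x → g ∈ set y
  K⇒ {j = j} {y = y} {g} (accessible (p , _)) x = ∈-mp y (p x) (∈-theorem y (axT j g))

  S-saturated : ∀ {f} → x ∈ 𝐂𝐤 ｛ f ｝ → Accessible j x y → y ∈ 𝐂𝐤 ｛ f ｝
  S-saturated {x = x} {j = j} x∈ a refl n = K⇒ a (∈-E⁻ x (x∈ refl (suc n)) j)

  -- Only the positive knowledge has to be put into the set to be extended:
  -- introspection then gives equality of knowledge.
  abstract
    ¬K⇒ : ∀ {g} → K j g ∉ set x → ∃[ y ] Accessible j x y × g ∉ set y
    ¬K⇒ {j = j} {x = x} {g} ∉x =
      extension , accessible (positive , λ {h} → negative h) ,
      λ ∈y → ∈-exclusive extension ∈y (extension-⊇ (inj₂ refl))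
      where
      open Lindenbaum (known j (set x) ∪ ｛ ¬ᶠ g ｝) (λ c → ∉x (known-⊩ x (contradictory-reductio c)))

      positive : known j (set x) ⊆ known j (set extension)
      positive {h} p = extension-⊇ (inj₁ (∈-mp x p (∈-theorem x (ax4 j h))))

      negative : ∀ h → K j h ∈ set extension → K j h ∈ set x
      negative h p = ¬∉⇒∈ x λ q →
        ∈-exclusive extension p (extension-⊇ (inj₁ (∈-mp x q (∈-theorem x (ax5 j h)))))

  -- Agreement of points up to a modal depth

  infix 4 _≈[_]_
  -- A record, like `Accessible` and `SameKnowledge`, so that the points can be inferred from a
  -- proof.
  record _≈[_]_ (z : Ω m k) (e : ℕ) (z′ : Ω m k) : Set where
    constructor agreement
    field agree : ∀ g → depth g ≤ e → (g ∈ set z → g ∈ set z′) × (g ∈ set z′ → g ∈ set z)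

  open _≈[_]_

  record SameKnowledge (j : Fin k) (e : ℕ) (z z′ : Ω m k) : Set where
    constructor sameKnowledge
    field
      agreeK : ∀ g → depth g ≤ e →
        (K j g ∈ set z → K j g ∈ set z′) × (K j g ∈ set z′ → K j g ∈ set z)

  open SameKnowledge

  ≈-refl : z ≈[ e ] z
  ≈-refl = agreement λ g _ → id , id

  ≈-sym : x ≈[ e ] y → y ≈[ e ] x
  ≈-sym s = agreement λ g d → swap (agree s g d)

  ≈-trans : x ≈[ e ] y → y ≈[ e ] z → x ≈[ e ] z
  ≈-trans s t = agreement λ g d →
    proj₁ (agree t g d) ∘ proj₁ (agree s g d) , proj₂ (agree s g d) ∘ proj₂ (agree t g d)

  ≈-≤ : e ≤ e′ → x ≈[ e′ ] y → x ≈[ e ] y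
  ≈-≤ l s = agreement λ g d → agree s g (≤-trans d l)

  SK-sym : SameKnowledge j e x y → SameKnowledge j e y x
  SK-sym s = sameKnowledge λ g d → swap (agreeK s g d)

  SK-trans : SameKnowledge j e x y → SameKnowledge j e y z → SameKnowledge j e x z
  SK-trans s t = sameKnowledge λ g d →
    proj₁ (agreeK t g d) ∘ proj₁ (agreeK s g d) , proj₂ (agreeK s g d) ∘ proj₂ (agreeK t g d)

  SK-≤ : e ≤ e′ → SameKnowledge j e′ x y → SameKnowledge j e x y
  SK-≤ l s = sameKnowledge λ g d → agreeK s g (≤-trans d l)

  ≈⇒SK : x ≈[ suc e ] y → SameKnowledge j e x y
  ≈⇒SK {j = j} s = sameKnowledge λ g d → agree s (K j g) (s≤s d)

  A⇒SK : Accessible j x y → SameKnowledge j e x y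
  A⇒SK (accessible (p , q)) = sameKnowledge λ g _ → p , q

  -- A formula of depth at most `e` is a Boolean combination of variables and of formulas `K j g`
  -- with `depth g` below `e`.
  ≈-intro : (∀ i → var i ∈ set x → var i ∈ set y) → (∀ i → var i ∈ set y → var i ∈ set x) →
    (∀ j e′ → suc e′ ≤ e → SameKnowledge j e′ x y) → x ≈[ e ] y
  ≈-intro {x = x} {y = y} {e = e} v v′ s = agreement cases
    where
    cases : ∀ g → depth g ≤ e → (g ∈ set x → g ∈ set y) × (g ∈ set y → g ∈ set x)
    cases (var i) d = v i , v′ i
    cases (¬ᶠ g)  d =
      (λ n → ∉⇒¬∈ y λ g∈ → ∈-exclusive x (proj₂ (cases g d) g∈) n) ,
      (λ n → ∉⇒¬∈ x λ g∈ → ∈-exclusive y (proj₁ (cases g d) g∈) n)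
    cases (g ∧ᶠ h) d with cases g (m⊔n≤o⇒m≤o _ _ d) | cases h (m⊔n≤o⇒n≤o _ _ d)
    ... | p , q | p′ , q′ =
      (λ c → ∈-pair y (p (∈-fst x c)) (p′ (∈-snd x c))) , (λ c → ∈-pair x (q (∈-fst y c)) (q′ (∈-snd y c)))
    cases (K j g) d = agreeK (s j (depth g) d) g ≤-refl

  -- Back and forth: if `g` is known on one side only, `¬K⇒` gives a possibility without `g` on the
  -- other, whose counterpart must contain `g`.
  SK-intro : ∀ {j : Fin k} {e} {x y : Ω m k} →
    (∀ u → Accessible j x u → ∃[ v ] (Accessible j y v × u ≈[ e ] v)) →
    (∀ v → Accessible j y v → ∃[ u ] (Accessible j x u × u ≈[ e ] v)) → SameKnowledge j e x y
  SK-intro {j = j} {e} {x} {y} forth back = sameKnowledge λ g d →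
    (λ p → dne λ q → one g d p q) , (λ p → dne λ q → two g d p q)
    where
    one : ∀ g → depth g ≤ e → K j g ∈ set x → K j g ∉ set y → ⊥
    one g d p q with ¬K⇒ q
    ... | v , a , g∉v with back v a
    ... | u , b , s = g∉v (proj₁ (agree s g d) (K⇒ b p))
    two : ∀ g → depth g ≤ e → K j g ∈ set y → K j g ∉ set x → ⊥
    two g d p q with ¬K⇒ q
    ... | u , a , g∉u with forth u a
    ... | v , b , s = g∉u (proj₂ (agree s g d) (K⇒ b p))

  -- Characteristic formulas of bounded depth

  -- Modulo depth e there are only finitely many points: the answers to the list
  -- criteria i k e settle all formulas of depth at most e.  The variable i is
  -- there because the language has no constant for truth.

  ⊤ᶠ : Fin m → 𝓛 m k
  ⊤ᶠ i = var i →ᶠ var i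

  signs : Fin m → List (𝓛 m k) → List (𝓛 m k)
  signs i []       = ⊤ᶠ i ∷ []
  signs i (g ∷ gs) = map (g ∧ᶠ_) (signs i gs) ++ map (¬ᶠ g ∧ᶠ_) (signs i gs)

  signs-hit : ∀ i gs (z : Ω m k) → ∃[ χ ] χ ∈ˡ signs i gs × χ ∈ set z
  signs-hit i []       z = ⊤ᶠ i , here refl , ∈-theorem z (⊢-I (var i))
  signs-hit i (g ∷ gs) z with signs-hit i gs z | Ω.complete z g
  ... | χ , χ∈ , χ∈z | inj₁ p = g ∧ᶠ χ , ∈-++⁺ˡ (∈-map⁺ (g ∧ᶠ_) χ∈) , ∈-pair z p χ∈z
  ... | χ , χ∈ , χ∈z | inj₂ p =
    ¬ᶠ g ∧ᶠ χ , ∈-++⁺ʳ (map (g ∧ᶠ_) (signs i gs)) (∈-map⁺ (¬ᶠ g ∧ᶠ_) χ∈) , ∈-pair z p χ∈z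

  signs-agree : ∀ i gs {χ} → χ ∈ˡ signs i gs → ∀ (z z′ : Ω m k) → χ ∈ set z → χ ∈ set z′ →
    ∀ {g} → g ∈ˡ gs → g ∈ set z → g ∈ set z′
  signs-agree i (g ∷ gs) χ∈ z z′ p p′ g∈ q with ∈-++⁻ (map (g ∧ᶠ_) (signs i gs)) χ∈
  signs-agree i (g ∷ gs) χ∈ z z′ p p′ g∈ q | inj₁ r with ∈-map⁻ (g ∧ᶠ_) r
  signs-agree i (g ∷ gs) χ∈ z z′ p p′ (here refl) q | inj₁ r | χ , χ∈′ , refl = ∈-fst z′ p′
  signs-agree i (g ∷ gs) χ∈ z z′ p p′ (there g∈)  q | inj₁ r | χ , χ∈′ , refl =
    signs-agree i gs χ∈′ z z′ (∈-snd z p) (∈-snd z′ p′) g∈ q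
  signs-agree i (g ∷ gs) χ∈ z z′ p p′ g∈ q | inj₂ r with ∈-map⁻ (¬ᶠ g ∧ᶠ_) r
  signs-agree i (g ∷ gs) χ∈ z z′ p p′ (here refl) q | inj₂ r | χ , χ∈′ , refl =
    contradiction (∈-fst z p) (∈-exclusive z q)
  signs-agree i (g ∷ gs) χ∈ z z′ p p′ (there g∈)  q | inj₂ r | χ , χ∈′ , refl =
    signs-agree i gs χ∈′ z z′ (∈-snd z p) (∈-snd z′ p′) g∈ q

  signs-depth : ∀ i (gs : List (𝓛 m k)) → All (λ g → depth g ≤ e) gs → All (λ χ → depth χ ≤ e) (signs i gs)
  signs-depth i []       _        = z≤n ∷ []
  signs-depth i (g ∷ gs) (d ∷ ds) = All.++⁺
    (All.map⁺ (All.map (⊔-lub d) (signs-depth i gs ds)))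
    (All.map⁺ (All.map (⊔-lub d) (signs-depth i gs ds)))

  atoms : ∀ m k → List (𝓛 m k)
  atoms m k = map var (allFin m)

  -- Hintikka normal forms: a type at depth `suc e` fixes the variables and, for each agent, which
  -- types at depth `e` it excludes.
  types : Fin m → ∀ k → ℕ → List (𝓛 m k)
  criteria : Fin m → ∀ k → ℕ → List (𝓛 m k)
  types i k e = signs i (criteria i k e)
  criteria {m} i k zero    = atoms m k
  criteria {m} i k (suc e) =
    atoms m k ++ cartesianProductWith (λ j χ → K j (¬ᶠ χ)) (allFin k) (types i k e)

  criteria-depth : ∀ (i : Fin m) k e → All (λ g → depth g ≤ e) (criteria i k e)
  criteria-depth {m} i k zero    = All.map⁺ (All.universal (λ _ → z≤n) (allFin m))
  criteria-depth {m} i k (suc e) = All.++⁺ (All.map⁺ (All.universal (λ _ → z≤n) (allFin m)))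
    (All.cartesianProductWith⁺ (≡.setoid _) (≡.setoid _) (λ j χ → K j (¬ᶠ χ)) (allFin k) (types i k e)
      λ _ χ∈ → s≤s (All.lookup (signs-depth i (criteria i k e) (criteria-depth i k e)) χ∈))

  atom∈criteria : ∀ (i : Fin m) k e x → var x ∈ˡ criteria i k e
  atom∈criteria i k zero    x = ∈-map⁺ var (∈-allFin x)
  atom∈criteria i k (suc e) x = ∈-++⁺ˡ (∈-map⁺ var (∈-allFin x))

  module _ (i : Fin m) where

    -- Induction on `e`: at points sharing a type each agent excludes the same types one level down,
    -- so possibilities match in both directions.
    types-separate : ∀ e {x y : Ω m k} {χ} → χ ∈ˡ types i k e → χ ∈ set x → χ ∈ set y → x ≈[ e ] y

    private
      forth : ∀ {x y : Ω m k} {j} e {χ} → χ ∈ˡ types i k (suc e) → χ ∈ set x → χ ∈ set y →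
        ∀ u → Accessible j x u → ∃[ v ] (Accessible j y v × u ≈[ e ] v)
      forth {k} {x} {y} {j} e χ∈ p q u a with signs-hit i (criteria i k e) u
      -- At `x`, hence at `y`, agent `j` does not know the negation of the type `ψ` of `u`.
      ... | ψ , ψ∈ , r with ¬K⇒ {x = y} (λ n → ∈-exclusive u r (K⇒ a
          (signs-agree i (criteria i k (suc e)) χ∈ y x q p
            (∈-++⁺ʳ (atoms m k) (∈-cartesianProductWith⁺ (λ j χ → K j (¬ᶠ χ)) (∈-allFin j) ψ∈)) n)))
      ... | v , b , n = v , b , types-separate e ψ∈ r (¬∉⇒∈ v n)

    types-separate {k} e {x} {y} {χ} χ∈ p q = ≈-intro
      (λ v → signs-agree i (criteria i k e) χ∈ x y p q (atom∈criteria i k e v))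
      (λ v → signs-agree i (criteria i k e) χ∈ y x q p (atom∈criteria i k e v))
      (knowledge e χ∈)
      where
      knowledge : ∀ e → χ ∈ˡ types i k e → ∀ j e′ → suc e′ ≤ e → SameKnowledge j e′ x y
      knowledge (suc e) χ∈ j e′ l = SK-≤ (s≤s⁻¹ l) (SK-intro (forth e χ∈ p q)
        λ v a → let u , b , s = forth e χ∈ q p v a in u , b , ≈-sym s)

    abstract
      -- One formula of depth at most `e` expresses agreement with `z`, so that agreement can be
      -- tested by knowledge and by basic open sets.
      characteristic : ∀ e (z : Ω m k) →
        ∃[ χ ] depth χ ≤ e × χ ∈ set z × (∀ z′ → χ ∈ set z′ → z′ ≈[ e ] z)
      characteristic {k} e z with signs-hit i (criteria i k e) z
      ... | χ , χ∈ , p = χ , All.lookup (signs-depth i (criteria i k e) (criteria-depth i k e)) χ∈ , p ,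
        λ z′ q → types-separate e χ∈ q p

  -- The converse of `SK-intro`: the characteristic formula of `u` has depth at most `e`, so its
  -- negation is unknown at `y` as it is at `x`.
  SK-elim : Fin m → ∀ {j : Fin k} {e x y u} → SameKnowledge j e x y → Accessible j x u →
    ∃[ v ] (Accessible j y v × u ≈[ e ] v)
  SK-elim i {j} {e} {x} {y} {u} s a with characteristic i e u
  ... | χ , d , χ∈u , c with ¬K⇒ {x = y} (λ n → ∈-exclusive u χ∈u (K⇒ a (proj₂ (agreeK s (¬ᶠ χ) d) n)))
  ... | v , b , n = v , b , ≈-sym (c v (¬∉⇒∈ v n))

  -- Kripke models, soundness and theories of states

  record Model (m k : ℕ) : Set₂ where
    field
      State     : Set₁
      Rel       : Fin k → State → State → Set
      rel-refl  : ∀ {j s} → Rel j s s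
      rel-sym   : ∀ {j s t} → Rel j s t → Rel j t s
      rel-trans : ∀ {j s t r} → Rel j s t → Rel j t r → Rel j s r
      Val       : State → Fin m → Set

  module Theory (M : Model m k) where
    open Model M

    infix 4 _⊨_
    _⊨_ : State → 𝓛 m k → Set₁
    s ⊨ var x  = Lift (lsuc 0ℓ) (Val s x)
    s ⊨ ¬ᶠ g   = ¬ (s ⊨ g)
    s ⊨ g ∧ᶠ h = s ⊨ g × s ⊨ h
    s ⊨ K j g  = ∀ t → Rel j s t → t ⊨ g

    ⊨-→⁺ : ∀ {s} g h → (s ⊨ g → s ⊨ h) → s ⊨ g →ᶠ h
    ⊨-→⁺ g h i (¬¬p , ¬q) = ¬¬p (λ p → ¬q (i p))

    ⊨-mp : ∀ {s} g h → s ⊨ g → s ⊨ g →ᶠ h → s ⊨ h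
    ⊨-mp g h p q = dne λ ¬r → q ((λ ¬p → ¬p p) , ¬r)

    eval-reflects : ∀ s (σ : ℕ → 𝓛 m k) p →
      Reflects (s ⊨ p [ σ ]) (eval (λ n → does (em {P = s ⊨ σ n})) p)
    eval-reflects s σ (var n)  = proof em
    eval-reflects s σ (¬ᶠ p)   = ¬-reflects (eval-reflects s σ p)
    eval-reflects s σ (p ∧ᶠ q) = eval-reflects s σ p ×-reflects eval-reflects s σ q

    soundness : ∀ {g} → S5⊢ g → ∀ s → s ⊨ g
    soundness (prop p t σ) s = invert (subst (Reflects (s ⊨ p [ σ ])) (t _) (eval-reflects s σ p))
    soundness (axK j g h) s = ⊨-→⁺ (K j g ∧ᶠ K j (g →ᶠ h)) (K j h)
      λ (p , q) t r → ⊨-mp g h (p t r) (q t r)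
    soundness (axT j g) s = ⊨-→⁺ (K j g) g λ p → p s rel-refl
    soundness (ax4 j g) s = ⊨-→⁺ (K j g) (K j (K j g)) λ p t r t′ r′ → p t′ (rel-trans r r′)
    soundness (ax5 j g) s = ⊨-→⁺ (¬ᶠ K j g) (K j (¬ᶠ K j g))
      λ n t r p → n λ t′ r′ → p t′ (rel-trans (rel-sym r) r′)
    soundness (mp {g} {h} d d′) s = ⊨-mp g h (soundness d s) (soundness d′ s)
    soundness (nec j d) s t r = soundness d t

    -- Truth in M lives in Set₁; excluded middle brings it down to Set.
    theory : State → Ω m k
    theory s = record
      { set        = λ g → True (em {P = s ⊨ g})
      ; complete   = complete
      ; consistent = λ gs g all d →
          let both = ⊨-mp (⋀ g gs) (g ∧ᶠ ¬ᶠ g) (⋀-true gs all) (soundness d s)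
          in proj₂ both (proj₁ both)
      }
      where
      complete : ∀ g → True (em {P = s ⊨ g}) ⊎ True (em {P = s ⊨ ¬ᶠ g})
      complete g with em {P = s ⊨ g}
      ... | yes p = inj₁ tt
      ... | no ¬p = inj₂ (fromWitness ¬p)

      ⋀-true : ∀ {g} gs → All (λ h → True (em {P = s ⊨ h})) gs → s ⊨ ⋀ g gs
      ⋀-true {g} []       _        = ⊨-→⁺ g g id
      ⋀-true (g ∷ [])     (p ∷ []) = toWitness p
      ⋀-true (g ∷ h ∷ gs) (p ∷ ps) = toWitness p , ⋀-true (h ∷ gs) ps

    theory⁺ : ∀ {s g} → s ⊨ g → g ∈ set (theory s)
    theory⁺ = fromWitness

    theory⁻ : ∀ {s g} → g ∈ set (theory s) → s ⊨ g
    theory⁻ = toWitness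

    theory-accessible : ∀ {j s t} → Rel j s t → Accessible j (theory s) (theory t)
    theory-accessible {j} {s} {t} r = accessible
      ( (λ {g} p → theory⁺ {t} {K j g} λ t′ r′ → theory⁻ {s} {K j g} p t′ (rel-trans r r′))
      , (λ {g} p → theory⁺ {s} {K j g} λ t′ r′ → theory⁻ {t} {K j g} p t′ (rel-trans (rel-sym r) r′)) )

    -- Points accessible from a theory need not be theories of related states, but these approximate
    -- them: otherwise the negation of a characteristic formula would be known.
    accessible-theory : Fin m → ∀ {j s u} e → Accessible j (theory s) u →
      ∃[ t ] (Rel j s t × theory t ≈[ e ] u)
    accessible-theory i {j} {s} {u} e a with characteristic i e u
    ... | χ , d , χ∈u , c = dne λ none → ∈-exclusive u χ∈u
      (K⇒ a (theory⁺ {g = K j (¬ᶠ χ)} λ t r p → none (t , r , c (theory t) (theory⁺ p))))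

  -- Copying points into a new possibility set

  pattern old x    = x , nothing
  pattern new x x∈ = x , just x∈

  -- Common knowledge of f survives the following surgery. A set V of points
  -- with the same j-knowledge at depth e is copied, the copies forming a new
  -- possibility set for j and otherwise keeping company with the originals.
  module Amalgam (i : Fin m) (f : 𝓛 m k) (j : Fin k) (e : ℕ) (depth-f : depth f ≤ suc e)
    (z : Ω m k) (V : Pred (Ω m k) (lsuc 0ℓ))
    (V⊆S : ∀ {v} → v ∈ V → v ∈ 𝐂𝐤 ｛ f ｝)
    (V-same : ∀ {v} → v ∈ V → SameKnowledge j e v z)
    (V-covers : ∀ {u} → Accessible j z u → ∃[ v ] (v ∈ V × v ≈[ e ] u)) where

    -- The disjoint union of `Ω m k` and `V`; a proof in `just` marks a copy.
    State : Set₁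
    State = Σ[ x ∈ Ω m k ] Maybe (x ∈ V)

    point : State → Ω m k
    point = proj₁

    Joined : State → State → Set
    Joined (old x)   (old y)   = Accessible j x y
    Joined (new _ _) (new _ _) = ⊤
    Joined _         _         = ⊥

    joined-refl : ∀ {s} → Joined s s
    joined-refl {old x}   = A-refl
    joined-refl {new _ _} = tt

    joined-sym : ∀ {s t} → Joined s t → Joined t s
    joined-sym {old _}   {old _}   a = A-sym a
    joined-sym {new _ _} {new _ _} _ = tt

    joined-trans : ∀ {s t r} → Joined s t → Joined t r → Joined s r
    joined-trans {old _}   {old _}   {old _}   a b = A-trans a b
    joined-trans {new _ _} {new _ _} {new _ _} _ _ = tt

    model : Model m k
    model = record
      { State     = State
      ; Rel       = λ l s t → (l ≢ j → Accessible l (point s) (point t)) × (l ≡ j → Joined s t)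
      ; rel-refl  = λ {_} {s} → (λ _ → A-refl) , (λ _ → joined-refl {s})
      ; rel-sym   = λ {_} {s} {t} (p , q) → (λ n → A-sym (p n)) , (λ n → joined-sym {s} {t} (q n))
      ; rel-trans = λ {_} {s} {t} {r} (p , q) (p′ , q′) →
          (λ n → A-trans (p n) (p′ n)) , (λ n → joined-trans {s} {t} {r} (q n) (q′ n))
      ; Val       = λ s x → var x ∈ set (point s)
      }

    open Model model using (Rel)
    open Theory model

    -- With `point-rel`, this makes `point` a bisimulation for agents other than `j`, and one up to
    -- depth `e` for `j`. Copies are all related for `j`; `V-same` matches them with genuine
    -- possibilities.
    rel-point : ∀ {l n} → l ≢ j ⊎ n ≤ e → ∀ s t → Rel l s t →
      ∃[ v ] (Accessible l (point s) v × point t ≈[ n ] v)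
    rel-point (inj₁ l≢j) s t (p , _) = point t , p l≢j , ≈-refl
    rel-point {l} (inj₂ n≤e) s t (p , q) with l Fin.≟ j
    rel-point (inj₂ n≤e) s         t           (p , q) | no l≢j   = point t , p l≢j , ≈-refl
    rel-point (inj₂ n≤e) (old x)   (old y)     (p , q) | yes refl = y , q refl , ≈-refl
    rel-point (inj₂ n≤e) (old x)   (new v v∈)  (p , q) | yes refl = ⊥-elim (q refl)
    rel-point (inj₂ n≤e) (new v v∈) (old y)    (p , q) | yes refl = ⊥-elim (q refl)
    rel-point (inj₂ n≤e) (new v v∈) (new w w∈) (p , q) | yes refl
      with SK-elim i (SK-trans (V-same w∈) (SK-sym (V-same v∈))) A-refl
    ... | u , a , s = u , a , ≈-≤ n≤e s

    point-rel : ∀ {l n u} → l ≢ j ⊎ n ≤ e → ∀ s → Accessible l (point s) u →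
      ∃[ t ] (Rel l s t × point t ≈[ n ] u)
    point-rel {u = u} c (old x) a = old u , ((λ _ → a) , (λ { refl → a })) , ≈-refl
    point-rel {u = u} (inj₁ l≢j) (new v v∈) a =
      old u , ((λ _ → a) , (λ l≡j → contradiction l≡j l≢j)) , ≈-refl
    point-rel {l} {u = u} (inj₂ n≤e) (new v v∈) a with l Fin.≟ j
    ... | no l≢j = old u , ((λ _ → a) , (λ l≡j → contradiction l≡j l≢j)) , ≈-refl
    -- The possibility `u` is first moved into the possibility set of `z`, where `V-covers` replaces
    -- it by a member of `V`.
    ... | yes refl with SK-elim i (V-same v∈) a
    ... | u′ , b , s with V-covers b
    ... | w , w∈ , s′ = new w w∈ , ((λ n → contradiction refl n) , (λ _ → tt)) , ≈-≤ n≤e (≈-trans s′ (≈-sym s))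

    knowledge : ∀ {l n} → l ≢ j ⊎ n ≤ e → (∀ s → theory s ≈[ n ] point s) →
      ∀ s → SameKnowledge l n (theory s) (point s)
    knowledge {l} {n} c ih s = SK-intro forth back
      where
      forth : ∀ u → Accessible l (theory s) u → ∃[ v ] (Accessible l (point s) v × u ≈[ n ] v)
      forth u a with accessible-theory i n a
      ... | t , r , p with rel-point c s t r
      ... | v , b , q = v , b , ≈-trans (≈-sym p) (≈-trans (ih t) q)

      back : ∀ v → Accessible l (point s) v → ∃[ u ] (Accessible l (theory s) u × u ≈[ n ] v)
      back v a with point-rel c s a
      ... | t , r , q = theory t , theory-accessible r , ≈-trans (ih t) q

    -- Knowledge can be compared at depth `e`, and the operator `K` adds a level, so agreement
    -- reaches `suc e`.
    theory≈point : ∀ n → n ≤ suc e → ∀ s → theory s ≈[ n ] point s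
    theory≈point n n≤e s = ≈-intro
      (λ x p → lower (theory⁻ {s} {var x} p)) (λ x p → theory⁺ {s} {var x} (lift p))
      (smaller n n≤e)
      where
      smaller : ∀ n → n ≤ suc e → ∀ l n′ → suc n′ ≤ n → SameKnowledge l n′ (theory s) (point s)
      smaller (suc n) (s≤s n≤e) l n′ (s≤s n′≤n) =
        SK-≤ n′≤n (knowledge (inj₂ n≤e) (theory≈point n (≤-trans n≤e (n≤1+n e))) s)

    rel-S : ∀ {l s t} → point s ∈ 𝐂𝐤 ｛ f ｝ → Rel l s t → point t ∈ 𝐂𝐤 ｛ f ｝
    rel-S {l} {s} {t} s∈ (p , q) with l Fin.≟ j
    ... | no l≢j = S-saturated s∈ (p l≢j)
    rel-S {s = old x}    {old y}    s∈ (p , q) | yes refl = S-saturated s∈ (q refl)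
    rel-S {s = old x}    {new _ _}  s∈ (p , q) | yes refl = ⊥-elim (q refl)
    rel-S {s = new _ _}  {old y}    s∈ (p , q) | yes refl = ⊥-elim (q refl)
    rel-S {s = new v v∈} {new w w∈} s∈ (p , q) | yes refl = V⊆S w∈

    -- Copies keep `f` because its depth is at most `suc e`; by `rel-S` the relations stay over
    -- points with `f` in common knowledge, so induction reaches `E^ n f`.
    theory∈S : ∀ s → point s ∈ 𝐂𝐤 ｛ f ｝ → theory s ∈ 𝐂𝐤 ｛ f ｝
    theory∈S s s∈ refl n = everyone n s s∈
      where
      everyone : ∀ n s → point s ∈ 𝐂𝐤 ｛ f ｝ → E^ n f ∈ set (theory s)
      everyone zero    s s∈ = proj₂ (agree (theory≈point (suc e) ≤-refl s) f depth-f) (s∈ refl 0)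
      everyone (suc n) s s∈ = ∈-E⁺ (theory s) λ l → theory⁺ {s} {K l (E^ n f)} λ t r →
        theory⁻ (everyone n t (rel-S {l} {s} {t} s∈ r))

    star : ∀ {v} → v ∈ V → Ω m k
    star {v} v∈ = theory (new v v∈)

    star≈ : ∀ {v} (v∈ : v ∈ V) → star v∈ ≈[ suc e ] v
    star≈ v∈ = theory≈point (suc e) ≤-refl (new _ v∈)

    accessible-star : ∀ {v u} (v∈ : v ∈ V) → Accessible j (star v∈) u → ∃[ w ] (w ∈ V × u ≈[ suc e ] w)
    accessible-star v∈ a with accessible-theory i (suc e) a
    ... | old x    , (_ , q) , s = ⊥-elim (q refl)
    ... | new w w∈ , _       , s = w , w∈ , ≈-trans (≈-sym s) (star≈ w∈)

  -- What is retained of the surgery: `j` cannot tell the copies apart and sees only types from `V`,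
  -- while the knowledge of other agents survives even at depth `suc e`, one level beyond what
  -- `star≈` gives.
  record Copies (f : 𝓛 m k) (j : Fin k) (e : ℕ) (V : Pred (Ω m k) (lsuc 0ℓ)) : Set₁ where
    field
      star            : ∀ {v} → v ∈ V → Ω m k
      star∈S          : ∀ {v} (v∈ : v ∈ V) → star v∈ ∈ 𝐂𝐤 ｛ f ｝
      star≈           : ∀ {v} (v∈ : v ∈ V) → star v∈ ≈[ suc e ] v
      star-accessible : ∀ {v w} (v∈ : v ∈ V) (w∈ : w ∈ V) → Accessible j (star v∈) (star w∈)
      accessible-star : ∀ {v u} (v∈ : v ∈ V) → Accessible j (star v∈) u → ∃[ w ] (w ∈ V × u ≈[ suc e ] w)
      star-same       : ∀ {l v} (v∈ : v ∈ V) → l ≢ j → SameKnowledge l (suc e) (star v∈) v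

  abstract
    copies : ∀ (i : Fin m) (f : 𝓛 m k) j e → depth f ≤ suc e → ∀ z (V : Pred (Ω m k) (lsuc 0ℓ)) →
      (∀ {v} → v ∈ V → v ∈ 𝐂𝐤 ｛ f ｝) → (∀ {v} → v ∈ V → SameKnowledge j e v z) →
      (∀ {u} → Accessible j z u → ∃[ v ] (v ∈ V × v ≈[ e ] u)) → Copies f j e V
    copies i f j e depth-f z V V⊆S V-same V-covers = record
      { star            = star
      ; star∈S          = λ v∈ → theory∈S (new _ v∈) (V⊆S v∈)
      ; star≈           = star≈
      ; star-accessible = λ v∈ w∈ → theory-accessible {j} {new _ v∈} {new _ w∈}
          ((λ n → contradiction refl n) , (λ _ → tt))
      ; accessible-star = accessible-star
      ; star-same       = λ v∈ l≢j → knowledge (inj₁ l≢j) (theory≈point (suc e) ≤-refl) (new _ v∈)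
      }
      where
      open Amalgam i f j e depth-f z V V⊆S V-same V-covers
      open Theory model

  -- Cells and their closures

  A-intro : (∀ e → x ≈[ e ] y) → Accessible j x y
  A-intro {j = j} s = accessible
    ((λ {g} → proj₁ (agree (s _) (K j g) ≤-refl)) , (λ {g} → proj₂ (agree (s _) (K j g) ≤-refl)))

  K-intro : ∀ {g} → (∀ y → Accessible j x y → g ∈ set y) → K j g ∈ set x
  K-intro everywhere-g = dne λ n → let y , a , g∉y = ¬K⇒ n in g∉y (everywhere-g y a)

  saturated⁺ : ∀ {C : Pred (Ω m k) (lsuc 0ℓ)} →
    (∀ {j x y} → Accessible j x y → x ∈ C → y ∈ C) → Saturated C
  saturated⁺ closed j P (x , P⊆ , ⊆P) (y , y∈P , y∈C) z∈P =
    closed (A-trans (A-sym (accessible {j = j} {z = x} (P⊆ y∈P))) (accessible {z = x} (P⊆ z∈P))) y∈C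

  saturated⁻ : ∀ {C : Pred (Ω m k) (lsuc 0ℓ)} → Saturated C →
    ∀ {j x y} → Accessible j x y → x ∈ C → y ∈ C
  saturated⁻ sat {j} {x} {y} (accessible a) x∈C =
    sat j (λ z → known j (set x) ≐ known j (set z)) (x , id , id) (x , (id , id) , x∈C) a

  -- The intersection is saturated, so minimality of `C` applies to it.
  cell-⊆ : ∀ {C D : Pred (Ω m k) (lsuc 0ℓ)} → IsCell C → IsCell D → C ≬ D → C ⊆ D
  cell-⊆ {C = C} {D} (_ , satC , minC) (_ , satD , _) meet x∈C =
    proj₂ (minC (C ∩ D) meet (saturated⁺ λ a (p , q) → saturated⁻ satC a p , saturated⁻ satD a q) proj₁ x∈C)

  -- Amounts to `y` lying in the closure of `C`, given characteristic formulas.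
  Approximates : Pred (Ω m k) (lsuc 0ℓ) → Ω m k → Set₁
  Approximates C y = ∀ e → ∃[ c ] (c ∈ C × c ≈[ e ] y)

  dense-approximates : Fin m → ∀ {C : Pred (Ω m k) (lsuc 0ℓ)} {S} → C DenseIn S →
    ∀ {y} → y ∈ S → Approximates C y
  dense-approximates i (_ , meets) {y} y∈S e with characteristic i e y
  ... | χ , _ , χ∈y , separates
    with meets (λ z → Lift (lsuc 0ℓ) (χ ∈ set z)) (λ (lift p) → χ , p , lift) (y , lift χ∈y , y∈S)
  ... | c , lift χ∈c , c∈C = c , c∈C , separates c χ∈c

  F-intro : ∀ {C : Pred (Ω m k) (lsuc 0ℓ)} {g} → Saturated C → (∀ {z} → z ∈ C → g ∈ set z) → g ∈ F C
  F-intro sat g∈ z∈C zero    = g∈ z∈C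
  F-intro sat g∈ {z} z∈C (suc n) =
    ∈-E⁺ z λ l → K-intro λ y a → F-intro sat g∈ (saturated⁻ sat a z∈C) n

  -- If no point of `C` had the type `χ` of `y`, then `¬ᶠ χ` would be common knowledge in `C`, hence
  -- a consequence of `T`, hence true at `y`.
  generated-approximates : Fin m → ∀ {C : Pred (Ω m k) (lsuc 0ℓ)} {T} → Saturated C → F C ⊆ C̲k̲ T →
    ∀ {y} → y ∈ 𝐂𝐤 T → Approximates C y
  generated-approximates i {C} sat F⊆ {y} y∈ e with characteristic i e y
  ... | χ , _ , χ∈y , separates = dne λ none →
    let n , ts , ts⊆T , taut = F⊆ (F-intro sat λ {z} z∈C → ∉⇒¬∈ z λ p → none (z , z∈C , separates z p))
    in ∈-exclusive y χ∈y
         (∈-mp y (∈-⋀⁺ y (map (E^ n) ts) (All.map⁺ (All.map (λ t∈ → y∈ t∈ n) ts⊆T))) (taut y))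

  -- Counting the points of a possibility set

  Distinct : ℕ → Fin k → ℕ → Ω m k → Set₁
  Distinct {k} {m} N l e z = Σ[ u ∈ (Fin N → Ω m k) ]
    ((∀ a → Accessible l z (u a)) × (∀ a b → u a ≈[ e ] u b → a ≡ b))

  -- Distinctness is measured at a finite depth for the sake of this transfer.
  distinct-transfer : Fin m → ∀ {N} {l : Fin k} {e z z′} → SameKnowledge l e z z′ →
    Distinct N l e z → Distinct N l e z′
  distinct-transfer i s (u , acc , inj) =
    (λ a → proj₁ (image a)) , (λ a → proj₁ (proj₂ (image a))) ,
    λ a b p → inj a b (≈-trans (proj₂ (proj₂ (image a))) (≈-trans p (≈-sym (proj₂ (proj₂ (image b))))))
    where
    image = λ a → SK-elim i s (acc a)

  distinct-≤ : ∀ {N e e′} {l : Fin k} {z : Ω m k} → e ≤ e′ → Distinct N l e z → Distinct N l e′ z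
  distinct-≤ e≤e′ (u , acc , inj) = u , acc , λ a b p → inj a b (≈-≤ e≤e′ p)

  distinct-bound : ∀ {n e} {l : Fin k} {z : Ω m k} →
    HasAtMost n (λ y → known l (set z) ≐ known l (set y)) → ¬ Distinct (suc n) l e z
  distinct-bound {n} {e} {l} {z} (zs , len , covers) (u , acc , inj) =
    let a , b , a<b , same = Fin.pigeonhole (s≤s len) (λ a → Any.index (cover a))
    in Fin.<⇒≢ a<b (inj a b (agreement λ g _ →
         let p , q = located a
             p′ , q′ = subst (λ c → u b ≈ lookup zs c) (sym same) (located b)
         in (λ h → q′ (p h)) , (λ h → q (p′ h))))
    where
    cover : ∀ a → Any (u a ≈_) zs
    cover a = covers {u a} (known-≐ (acc a))

    located : ∀ a → u a ≈ lookup zs (Any.index (cover a))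
    located a = lookup-index (cover a)

  -- Branching of knowledge

  module Branching (i : Fin m) (f : 𝓛 m k) where

    S : Pred (Ω m k) 0ℓ
    S = 𝐂𝐤 ｛ f ｝

    -- What l knows at depth e leaves open, for some e-type it holds
    -- possible, which (suc e)-type refines it.
    Branches : Fin k → ℕ → Ω m k → Set₁
    Branches l e z = ∃[ x ] ∃[ y ] (x ∈ S × y ∈ S × SameKnowledge l e x z × SameKnowledge l e y z ×
      x ≈[ e ] y × ¬ (x ≈[ suc e ] y))

    -- The largest `V` to which the copying applies at `z`.
    Full : Fin k → ℕ → Ω m k → Pred (Ω m k) (lsuc 0ℓ)
    Full l e z v = Lift (lsuc 0ℓ) (v ∈ S × SameKnowledge l e v z)

    fullCopies : ∀ l e → depth f ≤ suc e → ∀ z → z ∈ S → Copies f l e (Full l e z)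
    fullCopies l e depth-f z z∈S = copies i f l e depth-f z (Full l e z)
      (λ (lift (v∈S , _)) → v∈S) (λ (lift (_ , s)) → s)
      (λ {u} a → u , lift (S-saturated z∈S a , SK-sym (A⇒SK a)) , ≈-refl)

    -- As `x` and `y` share an `e`-type, which at most one of the `N` points has, one of their types
    -- at depth `suc e` is still missing. Copying `Full` puts it into one possibility set with the
    -- other `N`.
    grow : ∀ {N l e z} → depth f ≤ suc e → z ∈ S → Branches l e z → Distinct N l e z →
      ∃[ x ] (x ∈ S × Distinct (suc N) l (suc e) x)
    grow {N} {l} {e} {z} depth-f z∈S (x , y , x∈S , y∈S , x~z , y~z , x≈y , x≉y) (u , acc , inj) =
      star z∈V , star∈S z∈V , family , (λ a → star-accessible z∈V (proj₂ (member a))) , family-injective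
      where
      open Copies (fullCopies l e depth-f z z∈S)

      z∈V : z ∈ Full l e z
      z∈V = lift (z∈S , A⇒SK A-refl)

      fresh : ∃[ v ] (v ∈ Full l e z × (∀ a → ¬ (u a ≈[ suc e ] v)))
      fresh with em {P = ∃[ a ] (u a ≈[ suc e ] x)}
      ... | no none     = x , lift (x∈S , x~z) , λ a p → none (a , p)
      ... | yes (a , p) = y , lift (y∈S , y~z) , y-fresh
        where
        y-fresh : ∀ b → ¬ (u b ≈[ suc e ] y)
        y-fresh b q with inj a b (≈-trans (≈-≤ (n≤1+n e) p) (≈-trans x≈y (≈-sym (≈-≤ (n≤1+n e) q))))
        ... | refl = x≉y (≈-trans (≈-sym p) q)

      member : Fin (suc N) → ∃[ v ] v ∈ Full l e z
      member zero    = proj₁ fresh , proj₁ (proj₂ fresh)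
      member (suc a) = u a , lift (S-saturated z∈S (acc a) , SK-sym (A⇒SK (acc a)))

      family : Fin (suc N) → Ω m k
      family a = star (proj₂ (member a))

      member-injective : ∀ a b → proj₁ (member a) ≈[ suc e ] proj₁ (member b) → a ≡ b
      member-injective zero    zero    p = refl
      member-injective zero    (suc b) p = contradiction (≈-sym p) (proj₂ (proj₂ fresh) b)
      member-injective (suc a) zero    p = contradiction p (proj₂ (proj₂ fresh) a)
      member-injective (suc a) (suc b) p = cong suc (inj a b (≈-≤ (n≤1+n e) p))

      family-injective : ∀ a b → family a ≈[ suc e ] family b → a ≡ b
      family-injective a b p = member-injective a b
        (≈-trans (≈-sym (star≈ (proj₂ (member a)))) (≈-trans p (star≈ (proj₂ (member b)))))

    -- The (suc e)-type of y can be removed from what l holds possible at z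
    -- without changing the (suc e)-type of z.  The two versions of z are then
    -- put into one possibility set of j, where l's knowledge separates them.
    branches-other-≉ : ∀ {j l e z x y} → depth f ≤ suc e → l ≢ j → z ∈ S → x ∈ S → y ∈ S →
      SameKnowledge l e x z → SameKnowledge l e y z → x ≈[ e ] y → ¬ (x ≈[ suc e ] y) → ¬ (z ≈[ suc e ] y) →
      ∃[ w ] (w ∈ S × w ≈[ suc e ] z × Branches j (suc e) w)
    branches-other-≉ {j} {l} {e} {z} {x} {y} depth-f l≢j z∈S x∈S y∈S x~z y~z x≈y x≉y z≉y =
      p , M₃.star∈S z₁∈ , ≈-trans (M₃.star≈ z₁∈) (M₁.star≈ z∈V₁) ,
      p , q , M₃.star∈S z₁∈ , M₃.star∈S z₂∈ , A⇒SK A-refl , A⇒SK (M₃.star-accessible z₂∈ z₁∈) , p≈q , p≉q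
      where
      module M₁ = Copies (fullCopies l e depth-f z z∈S)
      module M₃ = Copies (fullCopies j e depth-f z z∈S)

      V₂ : Pred (Ω m k) (lsuc 0ℓ)
      V₂ v = v ∈ Full l e z × ¬ (v ≈[ suc e ] y)

      V₂-covers : ∀ {u} → Accessible l z u → ∃[ v ] (v ∈ V₂ × v ≈[ e ] u)
      V₂-covers {u} a with em {P = u ≈[ suc e ] y}
      ... | no u≉y  = u , (lift (S-saturated z∈S a , SK-sym (A⇒SK a)) , u≉y) , ≈-refl
      -- Removing the type of `y` loses no `e`-type, since `x` stands in for it.
      ... | yes u≈y = x , (lift (x∈S , x~z) , x≉y) , ≈-trans x≈y (≈-sym (≈-≤ (n≤1+n e) u≈y))

      module M₂ = Copies (copies i f l e depth-f z V₂
        (λ (lift (v∈S , _) , _) → v∈S) (λ (lift (_ , s) , _) → s) V₂-covers)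

      z∈V₁ : z ∈ Full l e z
      z∈V₁ = lift (z∈S , A⇒SK A-refl)

      y∈V₁ : y ∈ Full l e z
      y∈V₁ = lift (y∈S , y~z)

      z∈V₂ : z ∈ V₂
      z∈V₂ = z∈V₁ , z≉y

      z₁∈ : M₁.star z∈V₁ ∈ Full j e z
      z₁∈ = lift (M₁.star∈S z∈V₁ , ≈⇒SK (M₁.star≈ z∈V₁))

      z₂∈ : M₂.star z∈V₂ ∈ Full j e z
      z₂∈ = lift (M₂.star∈S z∈V₂ , ≈⇒SK (M₂.star≈ z∈V₂))

      p = M₃.star z₁∈
      q = M₃.star z₂∈

      p≈q : p ≈[ suc e ] q
      p≈q = ≈-trans (M₃.star≈ z₁∈) (≈-trans (M₁.star≈ z∈V₁)
        (≈-trans (≈-sym (M₂.star≈ z∈V₂)) (≈-sym (M₃.star≈ z₂∈))))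

      -- Agreement would give `l` equal knowledge at depth `suc e` in the two versions of `z`, but
      -- only the first admits the type of `y`.
      p≉q : ¬ (p ≈[ suc (suc e) ] q)
      p≉q s with SK-elim i
        (SK-trans (SK-sym (M₃.star-same z₁∈ l≢j)) (SK-trans (≈⇒SK s) (M₃.star-same z₂∈ l≢j)))
        (M₁.star-accessible z∈V₁ y∈V₁)
      ... | t , a , y*≈t with M₂.accessible-star z∈V₂ a
      ... | v , (_ , v≉y) , t≈v = v≉y (≈-trans (≈-sym (≈-trans y*≈t t≈v)) (M₁.star≈ y∈V₁))

    -- The point `z` cannot have the types of both `x` and `y` at depth `suc e`; one that it lacks
    -- is removed.
    branches-other : ∀ {j l e z} → depth f ≤ suc e → l ≢ j → z ∈ S → Branches l e z →
      ∃[ w ] (w ∈ S × w ≈[ suc e ] z × Branches j (suc e) w)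
    branches-other {e = e} {z} depth-f l≢j z∈S (x , y , x∈S , y∈S , x~z , y~z , x≈y , x≉y)
      with em {P = z ≈[ suc e ] y}
    ... | no z≉y  = branches-other-≉ depth-f l≢j z∈S x∈S y∈S x~z y~z x≈y x≉y z≉y
    ... | yes z≈y = branches-other-≉ depth-f l≢j z∈S y∈S x∈S y~z x~z (≈-sym x≈y) (λ p → x≉y (≈-sym p))
      (λ z≈x → x≉y (≈-trans (≈-sym z≈x) z≈y))

    BranchesNear : Fin k → ℕ → Ω m k → Set₁
    BranchesNear l e z = ∃[ e′ ] ∃[ x ] (e ≤ e′ × x ∈ S × x ≈[ e ] z × Branches l e′ x)

    BranchesArbitrarilyNear : Fin k → Ω m k → Set₁
    BranchesArbitrarilyNear l z = ∀ e → depth f ≤ e → BranchesNear l e z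

    -- Changing the agent raises the branching depth by one, which is harmless because only a lower
    -- bound on it is asked.
    near-other : ∀ {l j e z} → depth f ≤ e → BranchesNear l e z → BranchesNear j e z
    near-other {l} {j} depth-f near@(e′ , x , e≤e′ , x∈S , x≈z , b) with l Fin.≟ j
    ... | yes refl = near
    ... | no l≢j with branches-other (≤-trans depth-f (≤-trans e≤e′ (n≤1+n e′))) l≢j x∈S b
    ... | w , w∈S , w≈x , b′ =
      suc e′ , w , ≤-trans e≤e′ (n≤1+n e′) , w∈S ,
      ≈-trans (≈-≤ (≤-trans e≤e′ (n≤1+n e′)) w≈x) x≈z , b′

    -- Each round approximates `z` by a point of `C`, passes to a branching point nearby and applies
    -- `grow` there; the agent stays the same.
    unbounded : ∀ {C} → Fin k → Satisfiable C → C ⊆ S → (∀ {y} → y ∈ S → Approximates C y) →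
      (∀ {x} → x ∈ C → ∀ j → BranchesArbitrarilyNear j x) →
      ∀ N → ∃[ l ] ∃[ e ] ∃[ z ] (depth f ≤ e × z ∈ S × Distinct N l e z)
    unbounded l (c , c∈C) C⊆S dense near zero =
      l , depth f , c , ≤-refl , C⊆S c∈C , (λ ()) , (λ ()) , λ ()
    unbounded l sat C⊆S dense near (suc N) with unbounded l sat C⊆S dense near N
    ... | l′ , e , z , d , z∈S , distinct with dense z∈S (suc e)
    -- Agreement at depth `suc e` preserves knowledge at depth `e`, and with it the `N` distinct
    -- possibilities.
    ... | c , c∈C , c≈z with near c∈C l′ (suc e) (≤-trans d (n≤1+n e))
    ... | e′ , x , e<e′ , x∈S , x≈c , b with grow (≤-trans d (≤-trans (n≤1+n e) (≤-trans e<e′ (n≤1+n e′)))) x∈S b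
          (distinct-≤ (≤-trans (n≤1+n e) e<e′)
            (distinct-transfer i (≈⇒SK (≈-sym (≈-trans x≈c c≈z))) distinct))
    ... | y , y∈S , distinct′ =
      l′ , suc e′ , y , ≤-trans d (≤-trans (n≤1+n e) (≤-trans e<e′ (n≤1+n e′))) , y∈S , distinct′

    -- Without branching, each type held possible at `c` has a single refinement in `S` one level
    -- deeper, so matched possibilities keep agreeing and the agreement of `x` with `c` gains a
    -- level at each step.
    isolated : ∀ {e c} → c ∈ S → (∀ l → ¬ BranchesNear l e c) →
      ∀ {x} → x ∈ S → x ≈[ suc e ] c → ∀ n → x ≈[ suc (e + n) ] c
    isolated {e} {c} c∈S none {x} x∈S x≈c zero    = subst (λ n → x ≈[ suc n ] c) (sym (+-identityʳ e)) x≈c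
    isolated {e} {c} c∈S none {x} x∈S x≈c (suc n) = subst (λ n → x ≈[ suc n ] c) (sym (+-suc e n))
      (≈-intro (λ v → proj₁ (agree ih (var v) z≤n)) (λ v → proj₂ (agree ih (var v) z≤n))
        λ l e′ e′<n → SK-≤ (s≤s⁻¹ e′<n) (SK-intro forth back))
      where
      ih : x ≈[ suc (e + n) ] c
      ih = isolated c∈S none x∈S x≈c n

      refine : ∀ {l u v} → Accessible l x u → Accessible l c v → u ≈[ e + n ] v → u ≈[ suc (e + n) ] v
      refine {l} {u} {v} a b s = dne λ u≉v → none l (e + n , c , m≤m+n e n , c∈S , ≈-refl ,
        u , v , S-saturated x∈S a , S-saturated c∈S b ,
        SK-trans (SK-sym (A⇒SK a)) (≈⇒SK ih) , SK-sym (A⇒SK b) , s , u≉v)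

      forth : ∀ {l} u → Accessible l x u → ∃[ v ] (Accessible l c v × u ≈[ suc (e + n) ] v)
      forth u a = let v , b , s = SK-elim i (≈⇒SK ih) a in v , b , refine a b s

      back : ∀ {l} v → Accessible l c v → ∃[ u ] (Accessible l x u × u ≈[ suc (e + n) ] v)
      back v b = let u , a , s = SK-elim i (≈⇒SK (≈-sym ih)) b in u , a , refine a b (≈-sym s)

    isolated-accessible : ∀ {e c j} → c ∈ S → (∀ l → ¬ BranchesNear l e c) →
      ∀ {x} → x ∈ S → x ≈[ suc e ] c → Accessible j x c
    isolated-accessible {e} c∈S none x∈S x≈c = A-intro λ n →
      ≈-≤ (≤-trans (m≤n+m n e) (n≤1+n (e + n))) (isolated c∈S none x∈S x≈c n)

    -- Otherwise `c` is isolated in `S`, so `D` contains it, and overlapping cells coincide.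
    dense-branches : ∀ {C D l} → IsCell C → IsCell D → C ⊆ S → D ⊆ S → ¬ (C ≐ D) →
      (∀ {y} → y ∈ S → Approximates D y) → ∀ {c} → c ∈ C → BranchesArbitrarilyNear l c
    dense-branches {l = l} cellC cellD C⊆S D⊆S C≢D dense {c} c∈C e depth-f = dne λ none →
      let d , d∈D , d≈c = dense (C⊆S c∈C) (suc e)
          -- Isolation requires that no agent branches, while `none` concerns `l` alone;
          -- `near-other` bridges the gap.
          c∈D = saturated⁻ (proj₁ (proj₂ cellD))
            (isolated-accessible {j = l} (C⊆S c∈C) (λ j near → none (near-other depth-f near)) (D⊆S d∈D) d≈c) d∈D
      in C≢D (cell-⊆ cellC cellD (c , c∈C , c∈D) , cell-⊆ cellD cellC (c , c∈D , c∈C))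

-- The existence of `f` forces a variable to exist, as the characteristic formulas require.
someVariable : 𝓛 m k → Fin m
someVariable (var x)  = x
someVariable (¬ᶠ g)   = someVariable g
someVariable (g ∧ᶠ h) = someVariable g
someVariable (K j g)  = someVariable g

corollary1 : (∀ {ℓ} → ExcludedMiddle ℓ) →
    ∀ {m k : ℕ} (f : 𝓛 m k) → Generative f →
    ∀ (C : Pred (Ω m k) (lsuc 0ℓ)) → IsCell C → FiniteFanout C →
    F C ≐ C̲k̲ ｛ f ｝ →
    ¬ (∃[ n ] (∀ P → PossibilitySet P → P ⊆ C → HasAtMost n P))
corollary1 em {m} {k} f (2≤k , _ , _ , C₁ , C₂ , cell₁ , cell₂ , dense₁ , dense₂ , C₁≢C₂)
  C cell _ (F⊆ , _) (n , bound) =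
  few (unbounded agent (proj₁ cell₁) (proj₁ dense₁) (dense-approximates i dense₁) near (suc n))
  where
  open Classical em

  i : Fin m
  i = someVariable f

  open Branching i f

  agent : Fin k
  agent = fromℕ< (≤-trans (s≤s z≤n) 2≤k)

  near : ∀ {x} → x ∈ C₁ → ∀ j → BranchesArbitrarilyNear j x
  near x∈C₁ j = dense-branches {l = j} cell₁ cell₂ (proj₁ dense₁) (proj₁ dense₂) C₁≢C₂
    (dense-approximates i dense₂) x∈C₁

  satC : Saturated C
  satC = proj₁ (proj₂ cell)

  few : ¬ (∃[ l ] ∃[ e ] ∃[ z ] (depth f ≤ e × z ∈ S × Distinct (suc n) l e z))
  -- Since `f` generates the common knowledge in `C`, some `c` in `C` agrees with `z` deeply enough
  -- to inherit `suc n` distinct possibilities, one more than the bound allows.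
  few (l , e , z , _ , z∈S , distinct) with c , c∈C , c≈z ← generated-approximates i satC F⊆ z∈S (suc e) =
    distinct-bound
      (bound (λ y → known l (set c) ≐ known l (set y)) (l , c , id , id)
        (λ same → saturated⁻ satC (accessible {j = l} same) c∈C))
      (distinct-transfer i (≈⇒SK (≈-sym c≈z)) distinct)
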